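{- Let $k\ge 2$ and $r\ge 1$ be integers with $r\le k$. Then $$\sum_{s\mid (k,r)}\binom{k/s}{r/s}\varphi(s)\equiv 0\pmod{k},$$ where the sum is over all positive divisors $s$ of the greatest common divisor $(k,r)$.
   Context: $(k,r)$ denotes the greatest common divisor of $k$ and $r$, and $\varphi$ the Euler totient function. -}

module Defs where

open import Data.List.Base using (applyUpTo; filter; length; map; upTo)
open import Data.Nat.Base using (ℕ; suc; NonZero)
open import Data.Nat.Coprimality using (coprime?)
open import Data.Nat.Divisibility using (_∣?_)
open import Data.Nat.ListAction using (sum)

-- Euler's totient: the number of m with 1 ≤ m ≤ n coprime to n.
φ : ℕ → ℕ
φ n = length (filter (λ m → coprime? m n) (applyUpTo suc n))

-- The sum of f s over the positive divisors s of n, for n ≥ 1; s runs over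
-- suc i with i < n, so that f may divide by it.  (Every s divides 0, but
-- n = 0 gives the empty sum.)
sumOverDivisors : (n : ℕ) → ((s : ℕ) .{{_ : NonZero s}} → ℕ) → ℕ
sumOverDivisors n f = sum (map (λ i → f (suc i)) (filter (λ i → suc i ∣? n) (upTo n)))

syntax sumOverDivisors n (λ s → e) = ∑[ s ∣ n ] e

{-# OPTIONS --safe #-}

-- Burnside's lemma for the rotation action on the binary words of length k
-- and weight r: the numbers of fixed points of the k rotations add up to k times
-- the number of orbits.  The words fixed by the rotation by j are the s-th powers
-- of the words of length gcd j k and weight r / s, where s = k / gcd j k, so there
-- are (k / s) C (r / s) of them if s ∣ r and none otherwise; and each divisor s of
-- k arises from φ s of the rotations.
module Submission where

open import Data.Bool.Base using (Bool; true; false; if_then_else_)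
import Data.Bool.Properties as Bool
open import Data.List.Base hiding (sum; find)
open import Data.List.Membership.Propositional using (_∈_; _∉_; find)
open import Data.List.Membership.Propositional.Properties
open import Data.List.Membership.Propositional.Properties.WithK using (unique∧set⇒bag)
open import Data.List.Properties
open import Data.List.Relation.Binary.BagAndSetEquality using (∼bag⇒↭)
open import Data.List.Relation.Binary.Permutation.Propositional
  using (_↭_; ↭-sym; ↭-trans; ↭-refl; ↭-reflexive)
open import Data.List.Relation.Binary.Permutation.Propositional.Properties
  using (↭-length; ∈-resp-↭; drop-∷; ∷↭∷ʳ; filter-↭) renaming (map⁺ to map-↭)
open import Data.List.Relation.Unary.All as All using (All; []; _∷_)
open import Data.List.Relation.Unary.All.Properties using (¬Any⇒All¬)
open import Data.List.Relation.Unary.AllPairs using (AllPairs; []; _∷_)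
open import Data.List.Relation.Unary.Any using (Any; here; there; any?)
open import Data.List.Relation.Unary.Unique.Propositional using (Unique)
import Data.List.Relation.Unary.Unique.Propositional.Properties as Unique
open import Data.Nat.Base
  using (ℕ; zero; suc; _+_; _*_; _∸_; _/_; _≤_; _≥_; z≤n; s≤s;
         NonZero; >-nonZero; ≢-nonZero; ≢-nonZero⁻¹)
open import Data.Nat.Combinatorics using (_C_; nCk+nC[k+1]≡[n+1]C[k+1])
open import Data.Nat.Coprimality using (Coprime; coprime?; coprime⇒gcd≡1; gcd≡1⇒coprime)
open import Data.Nat.Divisibility
open import Data.Nat.DivMod using (m*n/n≡m)
open import Data.Nat.GCD
open import Data.Nat.GeneralisedArithmetic using (fold; fold-+)
open import Data.Nat.ListAction using (sum)
open import Data.Nat.ListAction.Properties using (sum-↭)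
open import Data.Nat.Properties
open import Data.Product.Base using (∃; _×_; _,_; proj₁; proj₂)
open import Data.Sum.Base using (inj₁; inj₂)
open import Function.Base using (_∘_; id; case_of_)
open import Function.Bundles using (mk⇔)
open import Relation.Binary.Definitions using (DecidableEquality)
open import Relation.Binary.PropositionalEquality hiding ([_])
open import Relation.Nullary using (Dec; does; yes; no; contradiction)
open import Relation.Unary using (Decidable)
open import Defs using (φ; sumOverDivisors)

open ≡-Reasoning

private
  variable
    A B : Set

-- Finite sums over lists and double counting.

∑ : List A → (A → ℕ) → ℕ
∑ xs f = sum (map f xs)

∑-cong : ∀ {f g : A → ℕ} xs → (∀ {x} → x ∈ xs → f x ≡ g x) → ∑ xs f ≡ ∑ xs g
∑-cong xs f≡g = cong sum (map-cong-local (All.tabulate f≡g))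

∑-const : ∀ (xs : List A) c → ∑ xs (λ _ → c) ≡ length xs * c
∑-const []       c = refl
∑-const (_ ∷ xs) c = cong (c +_) (∑-const xs c)

∑-zero : ∀ {f : A → ℕ} xs → (∀ {x} → x ∈ xs → f x ≡ 0) → ∑ xs f ≡ 0
∑-zero xs f≡0 = trans (∑-cong xs f≡0) (trans (∑-const xs 0) (*-zeroʳ (length xs)))

∑-+ : ∀ (f g : A → ℕ) xs → ∑ xs (λ x → f x + g x) ≡ ∑ xs f + ∑ xs g
∑-+ f g []       = refl
∑-+ f g (x ∷ xs) = begin
  f x + g x + ∑ xs (λ x → f x + g x)   ≡⟨ cong (f x + g x +_) (∑-+ f g xs) ⟩
  f x + g x + (∑ xs f + ∑ xs g)        ≡⟨ +-assoc (f x) (g x) _ ⟩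
  f x + (g x + (∑ xs f + ∑ xs g))      ≡⟨ cong (f x +_) (x∙yz≈y∙xz (g x) (∑ xs f) _) ⟩
  f x + (∑ xs f + (g x + ∑ xs g))      ≡⟨ +-assoc (f x) _ _ ⟨
  f x + ∑ xs f + (g x + ∑ xs g)        ∎
  where open import Algebra.Properties.CommutativeSemigroup +-commutativeSemigroup

∑-comm : ∀ (f : A → B → ℕ) xs ys →
         ∑ xs (λ x → ∑ ys (f x)) ≡ ∑ ys (λ y → ∑ xs (λ x → f x y))
∑-comm f []       ys = sym (∑-zero ys (λ _ → refl))
∑-comm f (x ∷ xs) ys = begin
  ∑ ys (f x) + ∑ xs (λ x → ∑ ys (f x))          ≡⟨ cong (∑ ys (f x) +_) (∑-comm f xs ys) ⟩
  ∑ ys (f x) + ∑ ys (λ y → ∑ xs (λ x → f x y))  ≡⟨ ∑-+ (f x) _ ys ⟨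
  ∑ ys (λ y → f x y + ∑ xs (λ x → f x y))       ∎

module _ {P : A → Set} (P? : Decidable P) where

  count : List A → ℕ
  count = length ∘ filter P?

  -- Trades a restricted index list for an indicator, so that a sum whose range depends on another
  -- index can be exchanged by `∑-comm`.
  ∑-filter : ∀ f xs → ∑ (filter P? xs) f ≡ ∑ xs (λ x → if does (P? x) then f x else 0)
  ∑-filter f []       = refl
  ∑-filter f (x ∷ xs) with does (P? x)
  ... | true  = cong (f x +_) (∑-filter f xs)
  ... | false = ∑-filter f xs

  count-∑ : ∀ xs → count xs ≡ ∑ xs (λ x → if does (P? x) then 1 else 0)
  count-∑ xs = begin
    count xs                    ≡⟨ *-identityʳ _ ⟨
    count xs * 1                ≡⟨ ∑-const (filter P? xs) 1 ⟨
    ∑ (filter P? xs) (λ _ → 1)  ≡⟨ ∑-filter _ xs ⟩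
    _                           ∎

  count-map : ∀ (f : B → A) xs → count (map f xs) ≡ length (filter (P? ∘ f) xs)
  count-map f []       = refl
  count-map f (x ∷ xs) with does (P? (f x))
  ... | true  = cong suc (count-map f xs)
  ... | false = count-map f xs

double-counting : ∀ {R : A → B → Set} (R? : ∀ x y → Dec (R x y)) xs ys →
                  ∑ xs (λ x → count (R? x) ys) ≡ ∑ ys (λ y → count (λ x → R? x y) xs)
double-counting R? xs ys = begin
  ∑ xs (λ x → count (R? x) ys)          ≡⟨ ∑-cong xs (λ {x} _ → count-∑ (R? x) ys) ⟩
  _                                     ≡⟨ ∑-comm _ xs ys ⟩
  _                                     ≡⟨ ∑-cong ys (λ {y} _ → count-∑ (λ x → R? x y) xs) ⟨
  ∑ ys (λ y → count (λ x → R? x y) xs)  ∎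

-- Without repetitions each membership has only one proof, so having the same members already gives
-- equality as bags. The bijective counts below rest on this.
unique⇒↭ : ∀ {xs ys : List A} → Unique xs → Unique ys →
           (∀ {x} → x ∈ xs → x ∈ ys) → (∀ {x} → x ∈ ys → x ∈ xs) → xs ↭ ys
unique⇒↭ xs! ys! xs⊆ys ys⊆xs = ∼bag⇒↭ (unique∧set⇒bag xs! ys! (mk⇔ xs⊆ys ys⊆xs))

filter-singleton : ∀ {P : A → Set} (P? : Decidable P) {xs x} → Unique xs → x ∈ xs → P x →
                   (∀ {y} → P y → y ≡ x) → filter P? xs ↭ [ x ]
filter-singleton P? {xs} xs! x∈xs px P⇒≡x =
  unique⇒↭ (Unique.filter⁺ P? xs!) ([] ∷ [])
    (λ y∈ → here (P⇒≡x (proj₂ (∈-filter⁻ P? {xs = xs} y∈))))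
    (λ { (here refl) → ∈-filter⁺ P? x∈xs px })

-- Fixed points of the iterates of a map.

module _ (σ : A → A) where

  fold-shift : ∀ x n → fold (σ x) σ n ≡ fold x σ (suc n)
  fold-shift x zero    = refl
  fold-shift x (suc n) = cong σ (fold-shift x n)

  fold-fixed-∣ : ∀ {x m n} → fold x σ m ≡ x → m ∣ n → fold x σ n ≡ x
  fold-fixed-∣ {x} {m} fix (divides q refl) = go q
    where
    go : ∀ q → fold x σ (q * m) ≡ x
    go zero    = refl
    go (suc q) = trans (fold-+ x σ m) (trans (cong (λ z → fold z σ m) (go q)) fix)

  -- Bézout's identity in the natural numbers: `gcd m n` plus a multiple of one argument is a
  -- multiple of the other. As `σ` need not be invertible, the added multiple is applied to `x`
  -- first, where it acts trivially.
  fold-fixed-gcd : ∀ {x} m n → fold x σ m ≡ x → fold x σ n ≡ x → fold x σ (gcd m n) ≡ x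
  fold-fixed-gcd {x} m n fixm fixn with Bézout.identity (gcd-GCD m n)
  ... | Bézout.+- p q eq = begin
    fold x σ (gcd m n)                   ≡⟨ cong (λ z → fold z σ (gcd m n)) (fold-fixed-∣ fixn (n∣m*n q)) ⟨
    fold (fold x σ (q * n)) σ (gcd m n)  ≡⟨ fold-+ x σ (gcd m n) ⟨
    fold x σ (gcd m n + q * n)           ≡⟨ cong (fold x σ) eq ⟩
    fold x σ (p * m)                     ≡⟨ fold-fixed-∣ fixm (n∣m*n p) ⟩
    x                                    ∎
  ... | Bézout.-+ p q eq = begin
    fold x σ (gcd m n)                   ≡⟨ cong (λ z → fold z σ (gcd m n)) (fold-fixed-∣ fixm (n∣m*n p)) ⟨
    fold (fold x σ (p * m)) σ (gcd m n)  ≡⟨ fold-+ x σ (gcd m n) ⟨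
    fold x σ (gcd m n + p * m)           ≡⟨ cong (fold x σ) eq ⟩
    fold x σ (q * n)                     ≡⟨ fold-fixed-∣ fixn (n∣m*n q) ⟩
    x                                    ∎

-- Burnside's lemma for the iterates of one periodic map.

module Burnside (_≟ᴬ_ : DecidableEquality A) (σ : A → A) (k : ℕ) .{{_ : NonZero k}}
                (X : List A) (X! : Unique X)
                (σ-closed : ∀ {x} → x ∈ X → σ x ∈ X)
                (σ-period : ∀ {x} → x ∈ X → fold x σ k ≡ x) where

  open import Data.List.Membership.DecPropositional _≟ᴬ_ using (_∈?_)

  -- Repetitions are kept, so the list has length `k` whatever the true size of the orbit. The
  -- exponents run from 1 to `k`, matching the range in `φ`.
  orbit : A → List A
  orbit x = applyUpTo (λ i → fold x σ (suc i)) k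

  fold-closed : ∀ {x} n → x ∈ X → fold x σ n ∈ X
  fold-closed zero    x∈X = x∈X
  fold-closed (suc n) x∈X = σ-closed (fold-closed n x∈X)

  x∈orbit[x] : ∀ {x} → x ∈ X → x ∈ orbit x
  -- The witness is the last entry, at index `pred k`: it is the `k`-th iterate, which is `x` by
  -- periodicity.
  x∈orbit[x] {x} x∈X = subst (_∈ orbit x) (trans (cong (fold x σ) (suc-pred k)) (σ-period x∈X))
    (∈-applyUpTo⁺ (λ i → fold x σ (suc i)) (≤-reflexive (suc-pred k)))

  orbit⊆X : ∀ {x y} → x ∈ X → y ∈ orbit x → y ∈ X
  orbit⊆X x∈X y∈ with i , _ , refl ← ∈-applyUpTo⁻ _ y∈ = fold-closed (suc i) x∈X

  -- Passing to `σ x` shifts the list by one place: the entry `σ x` lost at the front comes back at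
  -- the end as the iterate with exponent `k + 1`.
  orbit-σ : ∀ {x} → x ∈ X → orbit (σ x) ↭ orbit x
  orbit-σ {x} x∈X = drop-∷ (↭-trans (↭-reflexive eq) (↭-sym (∷↭∷ʳ (σ x) (orbit x))))
    where
    f = λ i → fold x σ (suc i)
    eq : σ x ∷ orbit (σ x) ≡ orbit x ∷ʳ σ x
    eq = begin
      σ x ∷ orbit (σ x)            ≡⟨ cong (σ x ∷_) (map-upTo _ k) ⟨
      σ x ∷ map (λ i → fold (σ x) σ (suc i)) (upTo k)
                                   ≡⟨ cong (σ x ∷_) (map-cong (fold-shift σ x ∘ suc) (upTo k)) ⟩
      σ x ∷ map (f ∘ suc) (upTo k) ≡⟨ cong (σ x ∷_) (map-upTo _ k) ⟩
      applyUpTo f (suc k)          ≡⟨ applyUpTo-∷ʳ f k ⟨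
      orbit x ∷ʳ f k               ≡⟨ cong (λ y → orbit x ∷ʳ σ y) (σ-period x∈X) ⟩
      orbit x ∷ʳ σ x               ∎

  orbit-↭ : ∀ {x y} → x ∈ X → y ∈ orbit x → orbit y ↭ orbit x
  orbit-↭ {x} x∈X y∈ with i , _ , refl ← ∈-applyUpTo⁻ _ y∈ = go (suc i)
    where
    go : ∀ n → orbit (fold x σ n) ↭ orbit x
    go zero    = ↭-refl
    go (suc n) = ↭-trans (orbit-σ (fold-closed n x∈X)) (go n)

  -- Both orbits are permutations of the orbit of the common point `z`.
  orbits-meet : ∀ {x y z} → x ∈ X → y ∈ X → z ∈ orbit x → z ∈ orbit y → y ∈ orbit x
  orbits-meet x∈X y∈X z∈x z∈y =
    ∈-resp-↭ (↭-trans (↭-sym (orbit-↭ y∈X z∈y)) (orbit-↭ x∈X z∈x)) (x∈orbit[x] y∈X)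

  -- One representative for each orbit that meets `xs`. The one-sided condition `separate` suffices
  -- for disjointness: by `orbits-meet`, a point shared by the orbits of `c` and a later `d` would
  -- put `d` in the orbit of `c`.
  record Transversal (xs : List A) : Set where
    field
      reps     : List A
      reps⊆X   : All (_∈ X) reps
      separate : AllPairs (λ c d → d ∉ orbit c) reps
      covers   : All (λ x → Any (λ c → x ∈ orbit c) reps) xs

  transversal : ∀ xs → All (_∈ X) xs → Transversal xs
  transversal []       []            = record { reps = [] ; reps⊆X = [] ; separate = [] ; covers = [] }
  transversal (x ∷ xs) (x∈X ∷ xs⊆X) with transversal xs xs⊆X
  ... | record { reps = cs ; reps⊆X = cs⊆X ; separate = sep ; covers = cov }
    with any? (λ c → x ∈? orbit c) cs
  ... | yes x∈cs = record { reps = cs ; reps⊆X = cs⊆X ; separate = sep ; covers = x∈cs ∷ cov }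
  ... | no  x∉cs = record
    { reps     = x ∷ cs
    ; reps⊆X   = x∈X ∷ cs⊆X
    -- An old representative `c` in the orbit of `x` would, by symmetry, put `x` in the orbit of
    -- `c`, which this branch excludes.
    ; separate = All.zipWith
                   (λ (c∈X , x∉c) c∈x → x∉c (orbits-meet c∈X x∈X (x∈orbit[x] c∈X) c∈x))
                   (cs⊆X , ¬Any⇒All¬ cs x∉cs)
                 ∷ sep
    ; covers   = here (x∈orbit[x] x∈X) ∷ All.map there cov
    }

  -- A multiplicity. On the diagonal, `hits x x` is the number of exponents from 1 to `k` that fix
  -- `x`, the order of its stabiliser.
  hits : A → A → ℕ
  hits c x = count (_≟ᴬ x) (orbit c)

  hits-∉ : ∀ {c x} → x ∉ orbit c → hits c x ≡ 0
  hits-∉ {c} {x} x∉ = cong length (filter-none (_≟ᴬ x) {orbit c}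
    (All.tabulate (λ y∈ y≡x → x∉ (subst (_∈ orbit c) y≡x y∈))))

  hits-∈ : ∀ {c x} → c ∈ X → x ∈ orbit c → hits c x ≡ hits x x
  hits-∈ {c} {x} c∈X x∈ = ↭-length (filter-↭ (_≟ᴬ x) (↭-sym (orbit-↭ c∈X x∈)))

  -- Exactly one representative has `x` in its orbit, and its list is a permutation of `orbit x`;
  -- all the others contribute 0.
  ∑-hits-reps : ∀ {cs x} → All (_∈ X) cs → AllPairs (λ c d → d ∉ orbit c) cs →
                Any (λ c → x ∈ orbit c) cs → ∑ cs (λ c → hits c x) ≡ hits x x
  ∑-hits-reps {c ∷ cs} {x} (c∈X ∷ cs⊆X) (c-sep ∷ _) (here x∈c) = begin
    hits c x + ∑ cs (λ d → hits d x)  ≡⟨ cong₂ _+_ (hits-∈ c∈X x∈c) (∑-zero cs zeros) ⟩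
    hits x x + 0                      ≡⟨ +-identityʳ _ ⟩
    hits x x                          ∎
    where
    zeros : ∀ {d} → d ∈ cs → hits d x ≡ 0
    zeros d∈cs = hits-∉ λ x∈d →
      All.lookup c-sep d∈cs (orbits-meet c∈X (All.lookup cs⊆X d∈cs) x∈c x∈d)
  ∑-hits-reps {c ∷ cs} {x} (c∈X ∷ cs⊆X) (c-sep ∷ sep) (there x∈cs) = cong₂ _+_
    (hits-∉ λ x∈c → case find x∈cs of λ (d , d∈cs , x∈d) →
      All.lookup c-sep d∈cs (orbits-meet c∈X (All.lookup cs⊆X d∈cs) x∈c x∈d))
    (∑-hits-reps cs⊆X sep x∈cs)

  -- Each of the `k` entries of `orbit c` equals exactly one member of the repetition-free list `X`.
  ∑-hits-X : ∀ {c} → c ∈ X → ∑ X (hits c) ≡ k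
  ∑-hits-X {c} c∈X = begin
    ∑ X (hits c)                                  ≡⟨ double-counting (λ x y → y ≟ᴬ x) X (orbit c) ⟩
    ∑ (orbit c) (λ y → count (λ x → y ≟ᴬ x) X)    ≡⟨ ∑-cong (orbit c) (λ y∈ → ↭-length
                                                       (filter-singleton _ X! (orbit⊆X c∈X y∈) refl sym)) ⟩
    ∑ (orbit c) (λ _ → 1)                         ≡⟨ ∑-const (orbit c) 1 ⟩
    length (orbit c) * 1                          ≡⟨ *-identityʳ _ ⟩
    length (orbit c)                              ≡⟨ length-applyUpTo _ k ⟩
    k                                             ∎

  -- Counting with multiplicity stands in for the orbit-stabiliser theorem: spread over the
  -- representatives and summed in the other order, the diagonal gives `k` for each orbit.
  ∑-hits-diagonal : k ∣ ∑ X (λ x → hits x x)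
  ∑-hits-diagonal = divides (length reps) (begin
    ∑ X (λ x → hits x x)                ≡⟨ ∑-cong X (λ x∈X → ∑-hits-reps reps⊆X separate (All.lookup covers x∈X)) ⟨
    ∑ X (λ x → ∑ reps (λ c → hits c x)) ≡⟨ ∑-comm (λ x c → hits c x) X reps ⟩
    ∑ reps (λ c → ∑ X (hits c))         ≡⟨ ∑-cong reps (∑-hits-X ∘ All.lookup reps⊆X) ⟩
    ∑ reps (λ _ → k)                    ≡⟨ ∑-const reps k ⟩
    length reps * k                     ∎)
    where open Transversal (transversal X (All.tabulate id))

  -- Counts the pairs of an exponent `j` and a point fixed by the `j`-th iterate, first by points
  -- and then by exponents.
  ∣-∑-fixed-points : k ∣ ∑ (applyUpTo suc k) (λ j → count (λ x → fold x σ j ≟ᴬ x) X)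
  ∣-∑-fixed-points = subst (k ∣_) (begin
    ∑ X (λ x → hits x x)                           ≡⟨ ∑-cong X (λ {x} _ → cong (count (_≟ᴬ x))
                                                        (sym (map-applyUpTo suc (fold x σ) k))) ⟩
    ∑ X (λ x → count (_≟ᴬ x) (map (fold x σ) js))  ≡⟨ ∑-cong X (λ {x} _ → count-map (_≟ᴬ x) (fold x σ) js) ⟩
    ∑ X (λ x → count (λ j → fold x σ j ≟ᴬ x) js)   ≡⟨ double-counting (λ x j → fold x σ j ≟ᴬ x) X js ⟩
    ∑ js (λ j → count (λ x → fold x σ j ≟ᴬ x) X)   ∎) ∑-hits-diagonal
    where js = applyUpTo suc k

-- Rotations and powers of words.

++-cancel-length : ∀ (u u′ : List A) {v v′} → length u ≡ length u′ → u ++ v ≡ u′ ++ v′ →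
                   u ≡ u′ × v ≡ v′
++-cancel-length []      []        _    eq = refl , eq
++-cancel-length (x ∷ u) (x′ ∷ u′) ∣u∣≡ eq
  with refl , eq′ ← ∷-injective eq
  with refl , v≡v′ ← ++-cancel-length u u′ (suc-injective ∣u∣≡) eq′ = refl , v≡v′

rotate : List A → List A
rotate []       = []
rotate (x ∷ xs) = xs ∷ʳ x

rotate-++ : ∀ (u v : List A) → fold (u ++ v) rotate (length u) ≡ v ++ u
rotate-++ []      v = sym (++-identityʳ v)
rotate-++ (x ∷ u) v = begin
  fold (x ∷ u ++ v) rotate (suc (length u)) ≡⟨ fold-shift rotate (x ∷ u ++ v) (length u) ⟨
  fold ((u ++ v) ∷ʳ x) rotate (length u)    ≡⟨ cong (λ w → fold w rotate (length u)) (++-assoc u v [ x ]) ⟩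
  fold (u ++ v ∷ʳ x) rotate (length u)      ≡⟨ rotate-++ u (v ∷ʳ x) ⟩
  v ∷ʳ x ++ u                               ≡⟨ ++-assoc v [ x ] u ⟩
  v ++ x ∷ u                                ∎

rotate-length : ∀ (u : List A) → fold u rotate (length u) ≡ u
rotate-length u = trans (cong (λ w → fold w rotate (length u)) (sym (++-identityʳ u))) (rotate-++ u [])

power : ℕ → List A → List A
power s u = concat (replicate s u)

power-comm : ∀ s (u : List A) → u ++ power s u ≡ power s u ++ u
power-comm zero    u = ++-identityʳ u
power-comm (suc s) u = trans (cong (u ++_) (power-comm s u)) (sym (++-assoc u (power s u) u))

length-power : ∀ s (u : List A) → length (power s u) ≡ s * length u
length-power zero    u = refl
length-power (suc s) u = trans (length-++ u) (cong (length u +_) (length-power s u))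

-- An instance of the fact that commuting words are powers of a common word.
comm⇒power : ∀ s (u v : List A) → length v ≡ s * length u → u ++ v ≡ v ++ u → v ≡ power s u
comm⇒power zero    u []  _    _  = refl
comm⇒power (suc s) u v   ∣v∣≡ eq = begin
  v                     ≡⟨ take++drop≡id ∣u∣ v ⟨
  take ∣u∣ v ++ drop ∣u∣ v ≡⟨ cong (_++ drop ∣u∣ v) u≡ ⟨
  u ++ drop ∣u∣ v        ≡⟨ cong (u ++_) (comm⇒power s u (drop ∣u∣ v) ∣drop∣ comm) ⟩
  u ++ power s u         ∎
  where
  ∣u∣ = length u
  ∣take∣ : ∣u∣ ≡ length (take ∣u∣ v)
  ∣take∣ = sym (trans (length-take ∣u∣ v) (m≤n⇒m⊓n≡m (subst (∣u∣ ≤_) (sym ∣v∣≡) (m≤m+n ∣u∣ (s * ∣u∣)))))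
  split : u ≡ take ∣u∣ v × v ≡ drop ∣u∣ v ++ u
  split = ++-cancel-length u (take ∣u∣ v) ∣take∣ (begin
    u ++ v                          ≡⟨ eq ⟩
    v ++ u                          ≡⟨ cong (_++ u) (take++drop≡id ∣u∣ v) ⟨
    (take ∣u∣ v ++ drop ∣u∣ v) ++ u ≡⟨ ++-assoc (take ∣u∣ v) _ u ⟩
    take ∣u∣ v ++ drop ∣u∣ v ++ u   ∎)
  u≡ = proj₁ split
  ∣drop∣ : length (drop ∣u∣ v) ≡ s * ∣u∣
  ∣drop∣ = trans (length-drop ∣u∣ v) (trans (cong (_∸ ∣u∣) ∣v∣≡) (m+n∸m≡n ∣u∣ (s * ∣u∣)))
  comm : u ++ drop ∣u∣ v ≡ drop ∣u∣ v ++ u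
  comm = begin
    u ++ drop ∣u∣ v           ≡⟨ cong (_++ drop ∣u∣ v) u≡ ⟩
    take ∣u∣ v ++ drop ∣u∣ v  ≡⟨ take++drop≡id ∣u∣ v ⟩
    v                         ≡⟨ proj₂ split ⟩
    drop ∣u∣ v ++ u           ∎

power-fixed : ∀ s (u : List A) → fold (power s u) rotate (length u) ≡ power s u
-- The zeroth power is the empty word, which one rotation fixes, and hence any number of rotations.
power-fixed zero    u = fold-fixed-∣ rotate {m = 1} refl (1∣ length u)
power-fixed (suc s) u = trans (rotate-++ u (power s u)) (sym (power-comm s u))

-- Cut `w` after `d` letters: `d` rotations swap the two pieces, so these commute and the second is
-- a power of the first. The exponent `suc s` ensures that `w` has at least `d` letters.
fixed⇒power : ∀ s d (w : List A) → length w ≡ suc s * d → fold w rotate d ≡ w →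
              length (take d w) ≡ d × w ≡ power (suc s) (take d w)
fixed⇒power s d w ∣w∣≡ fix = ∣u∣≡d , (begin
  w                 ≡⟨ take++drop≡id d w ⟨
  u ++ v            ≡⟨ cong (u ++_) (comm⇒power s u v ∣v∣ comm) ⟩
  u ++ power s u    ∎)
  where
  u = take d w
  v = drop d w
  ∣u∣≡d : length u ≡ d
  ∣u∣≡d = trans (length-take d w) (m≤n⇒m⊓n≡m (subst (d ≤_) (sym ∣w∣≡) (m≤m+n d (s * d))))
  ∣v∣ : length v ≡ s * length u
  ∣v∣ = begin
    length v       ≡⟨ length-drop d w ⟩
    length w ∸ d   ≡⟨ cong (_∸ d) ∣w∣≡ ⟩
    d + s * d ∸ d  ≡⟨ m+n∸m≡n d (s * d) ⟩
    s * d          ≡⟨ cong (s *_) ∣u∣≡d ⟨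
    s * length u   ∎
  comm : u ++ v ≡ v ++ u
  comm = begin
    u ++ v                           ≡⟨ take++drop≡id d w ⟩
    w                                ≡⟨ fix ⟨
    fold w rotate d                  ≡⟨ cong₂ (λ w d → fold w rotate d) (take++drop≡id d w) ∣u∣≡d ⟨
    fold (u ++ v) rotate (length u)  ≡⟨ rotate-++ u v ⟩
    v ++ u                           ∎

power-injective : ∀ s {u v : List A} → power (suc s) u ≡ power (suc s) v → u ≡ v
power-injective s {u} {v} eq = proj₁ (++-cancel-length u v ∣u∣≡∣v∣ eq)
  where
  ∣u∣≡∣v∣ : length u ≡ length v
  ∣u∣≡∣v∣ = *-cancelˡ-≡ _ _ (suc s)
    (trans (sym (length-power (suc s) u)) (trans (cong length eq) (length-power (suc s) v)))

-- Binary words of given length and weight.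

weight : List Bool → ℕ
weight = length ∘ filter (Bool._≟ true)

weight-++ : ∀ u v → weight (u ++ v) ≡ weight u + weight v
weight-++ u v = trans (cong length (filter-++ (Bool._≟ true) u v)) (length-++ (filter (Bool._≟ true) u))

weight-power : ∀ s u → weight (power s u) ≡ s * weight u
weight-power zero    u = refl
weight-power (suc s) u = trans (weight-++ u (power s u)) (cong (weight u +_) (weight-power s u))

length-rotate : ∀ (w : List A) → length (rotate w) ≡ length w
length-rotate []      = refl
length-rotate (x ∷ w) = trans (length-++ w) (+-comm (length w) 1)

weight-rotate : ∀ w → weight (rotate w) ≡ weight w
weight-rotate []      = refl
weight-rotate (x ∷ w) = begin
  weight (w ∷ʳ x)          ≡⟨ weight-++ w [ x ] ⟩
  weight w + weight [ x ]  ≡⟨ +-comm (weight w) _ ⟩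
  weight [ x ] + weight w  ≡⟨ weight-++ [ x ] w ⟨
  weight (x ∷ w)           ∎

-- Splitting on the first letter follows Pascal's rule, so the binomial count is a direct induction.
words : ℕ → ℕ → List (List Bool)
words zero    zero    = [ [] ]
words zero    (suc r) = []
words (suc k) zero    = map (false ∷_) (words k zero)
words (suc k) (suc r) = map (true ∷_) (words k r) ++ map (false ∷_) (words k (suc r))

∈-words⁺ : ∀ w → w ∈ words (length w) (weight w)
∈-words⁺ []          = here refl
∈-words⁺ (true  ∷ w) = ∈-++⁺ˡ (∈-map⁺ (true ∷_) (∈-words⁺ w))
∈-words⁺ (false ∷ w) with weight w | ∈-words⁺ w
... | zero  | w∈ = ∈-map⁺ (false ∷_) w∈
... | suc r | w∈ = ∈-++⁺ʳ (map (true ∷_) (words (length w) r)) (∈-map⁺ (false ∷_) w∈)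

∈-words⁻ : ∀ k r {w} → w ∈ words k r → length w ≡ k × weight w ≡ r
∈-words⁻ zero    zero    (here refl) = refl , refl
∈-words⁻ (suc k) zero    w∈ with _ , v∈ , refl ← ∈-map⁻ (false ∷_) w∈
  with refl , eq ← ∈-words⁻ k zero v∈ = refl , eq
∈-words⁻ (suc k) (suc r) w∈ with ∈-++⁻ (map (true ∷_) (words k r)) w∈
∈-words⁻ (suc k) (suc r) w∈ | inj₁ w∈₁ with _ , v∈ , refl ← ∈-map⁻ (true ∷_) w∈₁
  with refl , refl ← ∈-words⁻ k r v∈ = refl , refl
∈-words⁻ (suc k) (suc r) w∈ | inj₂ w∈₂ with _ , v∈ , refl ← ∈-map⁻ (false ∷_) w∈₂
  with refl , eq ← ∈-words⁻ k (suc r) v∈ = refl , eq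

∈-words : ∀ {k r w} → length w ≡ k → weight w ≡ r → w ∈ words k r
∈-words {w = w} refl refl = ∈-words⁺ w

words-unique : ∀ k r → Unique (words k r)
words-unique zero    zero    = [] ∷ []
words-unique zero    (suc r) = []
words-unique (suc k) zero    = Unique.map⁺ ∷-injectiveʳ (words-unique k zero)
words-unique (suc k) (suc r) = Unique.++⁺
  (Unique.map⁺ ∷-injectiveʳ (words-unique k r))
  (Unique.map⁺ ∷-injectiveʳ (words-unique k (suc r)))
  λ (w∈₁ , w∈₂) → case ∈-map⁻ (true ∷_) w∈₁ , ∈-map⁻ (false ∷_) w∈₂ of λ
    { ((_ , _ , refl) , (_ , _ , ())) }

length-words : ∀ k r → length (words k r) ≡ k C r
length-words zero    zero    = refl
length-words zero    (suc r) = refl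
length-words (suc k) zero    = trans (length-map (false ∷_) (words k zero)) (length-words k zero)
length-words (suc k) (suc r) = begin
  length (words (suc k) (suc r))                   ≡⟨ length-++ (map (true ∷_) (words k r)) ⟩
  length (map (true ∷_) (words k r)) +
    length (map (false ∷_) (words k (suc r)))      ≡⟨ cong₂ _+_ (length-map _ (words k r)) (length-map _ (words k (suc r))) ⟩
  length (words k r) + length (words k (suc r))    ≡⟨ cong₂ _+_ (length-words k r) (length-words k (suc r)) ⟩
  k C r + k C suc r                                ≡⟨ nCk+nC[k+1]≡[n+1]C[k+1] k r ⟩
  suc k C suc r                                    ∎

_≟ʷ_ : DecidableEquality (List Bool)
_≟ʷ_ = ≡-dec Bool._≟_

-- Words fixed by a given rotation.

fixedWords : ℕ → ℕ → ℕ → List (List Bool)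
fixedWords k r j = filter (λ w → fold w rotate j ≟ʷ w) (words k r)

∈-fixedWords⁻ : ∀ {k r} j s {w} → gcd j k * suc s ≡ k → w ∈ fixedWords k r j →
                ∃ λ u → length u ≡ gcd j k × suc s * weight u ≡ r × w ≡ power (suc s) u
∈-fixedWords⁻ {k} {r} j s {w} gs≡k w∈
  with w∈W , fix ← ∈-filter⁻ (λ w → fold w rotate j ≟ʷ w) {xs = words k r} w∈
  with refl , refl ← ∈-words⁻ k r w∈W
  with ∣u∣≡ , w≡ ← fixed⇒power s (gcd j k) w (trans (sym gs≡k) (*-comm (gcd j k) (suc s)))
                     -- Rotation by `k`, the length of `w`, also fixes `w`, so rotation by `gcd j k`
                     -- does. Since `gcd j k` divides `k`, the word is a power.
                     (fold-fixed-gcd rotate j k fix (rotate-length w))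
  = take (gcd j k) w , ∣u∣≡ , trans (sym (weight-power (suc s) (take (gcd j k) w))) (cong weight (sym w≡)) , w≡

∈-fixedWords⁺ : ∀ {k r} j s {u} → gcd j k * suc s ≡ k → length u ≡ gcd j k →
                suc s * weight u ≡ r → power (suc s) u ∈ fixedWords k r j
∈-fixedWords⁺ {k} j s {u} gs≡k ∣u∣≡ weight≡ = ∈-filter⁺ _
  (∈-words (trans (length-power (suc s) u)
             (trans (cong (suc s *_) ∣u∣≡) (trans (*-comm (suc s) (gcd j k)) gs≡k)))
           (trans (weight-power (suc s) u) weight≡))
  (fold-fixed-∣ rotate (power-fixed (suc s) u) (subst (_∣ j) (sym ∣u∣≡) (gcd[m,n]∣m j k)))

-- Taking the `suc s`-th power is a bijection from the words of length `gcd j k` and weight `m` onto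
-- the fixed words.
length-fixedWords : ∀ {k} j s m → gcd j k * suc s ≡ k →
                    length (fixedWords k (m * suc s) j) ≡ gcd j k C m
length-fixedWords {k} j s m gs≡k = begin
  length (fixedWords k (m * suc s) j)                 ≡⟨ ↭-length (unique⇒↭
                                                           (Unique.filter⁺ _ (words-unique k (m * suc s)))
                                                           (Unique.map⁺ (power-injective s) (words-unique (gcd j k) m))
                                                           to from) ⟩
  length (map (power (suc s)) (words (gcd j k) m))    ≡⟨ length-map _ (words (gcd j k) m) ⟩
  length (words (gcd j k) m)                          ≡⟨ length-words (gcd j k) m ⟩
  gcd j k C m                                         ∎
  where
  to : ∀ {w} → w ∈ fixedWords k (m * suc s) j → w ∈ map (power (suc s)) (words (gcd j k) m)
  to w∈ with u , ∣u∣≡ , weight≡ , refl ← ∈-fixedWords⁻ j s gs≡k w∈ =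
    ∈-map⁺ (power (suc s)) (∈-words ∣u∣≡ (*-cancelˡ-≡ _ _ (suc s) (trans weight≡ (*-comm m (suc s)))))
  from : ∀ {w} → w ∈ map (power (suc s)) (words (gcd j k) m) → w ∈ fixedWords k (m * suc s) j
  from w∈ with u , u∈ , refl ← ∈-map⁻ (power (suc s)) w∈
    with ∣u∣≡ , refl ← ∈-words⁻ (gcd j k) m u∈ = ∈-fixedWords⁺ j s gs≡k ∣u∣≡ (*-comm (suc s) (weight u))

-- A fixed word is a `suc s`-th power, so its weight is a multiple of `suc s`.
length-fixedWords-∤ : ∀ {k r} j s → gcd j k * suc s ≡ k → suc s ∤ r → length (fixedWords k r j) ≡ 0
length-fixedWords-∤ {k} {r} j s gs≡k s∤r with fixedWords k r j in eq
... | []    = refl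
... | w ∷ _ = case ∈-fixedWords⁻ j s gs≡k (subst (w ∈_) (sym eq) (here refl)) of
  λ (u , _ , weight≡ , _) → contradiction (divides (weight u) (trans (sym weight≡) (*-comm (suc s) _))) s∤r

-- Rotations with a given cofactor and the totient.

∈-1⋯⁺ : ∀ {n} i .{{_ : NonZero i}} → i ≤ n → i ∈ applyUpTo suc n
∈-1⋯⁺ (suc i) i<n = ∈-applyUpTo⁺ suc i<n

∈-1⋯⁻ : ∀ {n i} → i ∈ applyUpTo suc n → NonZero i × i ≤ n
∈-1⋯⁻ i∈ with _ , i<n , refl ← ∈-applyUpTo⁻ suc i∈ = _ , i<n

1⋯-unique : ∀ n → Unique (applyUpTo suc n)
1⋯-unique n = Unique.applyUpTo⁺₁ suc n (λ i<j _ → <⇒≢ (s≤s i<j))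

-- Write `k` as `d * s`. The condition says that `gcd j k` is `d`, and such `j` are the products
-- `d * q` with `q` between 1 and `s` and coprime to `s`.
count-gcd≡φ : ∀ {k} s .{{_ : NonZero k}} .{{_ : NonZero s}} → s ∣ k →
              count (λ j → gcd j k * s ≟ k) (applyUpTo suc k) ≡ φ s
count-gcd≡φ s (divides d refl) = trans
  (↭-length (unique⇒↭ (Unique.filter⁺ ds? (1⋯-unique (d * s)))
                      (Unique.map⁺ (*-cancelˡ-≡ _ _ d) (Unique.filter⁺ ⊥s? (1⋯-unique s)))
                      to from))
  (length-map (d *_) coprimes)
  where
  ds? : Decidable (λ j → gcd j (d * s) * s ≡ d * s)
  ds? j = gcd j (d * s) * s ≟ d * s
  ⊥s? : Decidable (λ m → Coprime m s)
  ⊥s? m = coprime? m s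
  coprimes : List ℕ
  coprimes = filter ⊥s? (applyUpTo suc s)
  instance
    d≢0 : NonZero d
    d≢0 = m*n≢0⇒m≢0 d {s}
  to : ∀ {j} → j ∈ filter ds? (applyUpTo suc (d * s)) →
       j ∈ map (d *_) coprimes
  to {j} j∈ with j∈js , gs≡ds ← ∈-filter⁻ ds? {xs = applyUpTo suc (d * s)} j∈
    with d∣j ← subst (_∣ j) (*-cancelʳ-≡ _ d s gs≡ds) (gcd[m,n]∣m j (d * s))
    with divides q refl ← d∣j
    with qd≢0 , qd≤ds ← ∈-1⋯⁻ j∈js =
    subst (_∈ map (d *_) coprimes) (*-comm d q) (∈-map⁺ (d *_) (∈-filter⁺ ⊥s?
      (∈-1⋯⁺ q {{m*n≢0⇒m≢0 q {{qd≢0}}}} (*-cancelˡ-≤ d (subst (_≤ d * s) (*-comm q d) qd≤ds)))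
      (gcd≡1⇒coprime (*-cancelˡ-≡ _ 1 d (begin
        d * gcd q s         ≡⟨ c*gcd[m,n]≡gcd[cm,cn] d q s ⟩
        gcd (d * q) (d * s) ≡⟨ cong (λ j → gcd j (d * s)) (*-comm d q) ⟩
        gcd (q * d) (d * s) ≡⟨ *-cancelʳ-≡ _ d s gs≡ds ⟩
        d                   ≡⟨ *-identityʳ d ⟨
        d * 1               ∎)))))
  from : ∀ {j} → j ∈ map (d *_) coprimes →
         j ∈ filter ds? (applyUpTo suc (d * s))
  from j∈ with q , q∈ , refl ← ∈-map⁻ (d *_) j∈
    with q∈S , q⊥s ← ∈-filter⁻ ⊥s? {xs = applyUpTo suc s} q∈
    with q≢0 , q≤s ← ∈-1⋯⁻ q∈S =
    ∈-filter⁺ ds? (∈-1⋯⁺ (d * q) {{m*n≢0 d q {{d≢0}} {{q≢0}}}} (*-monoʳ-≤ d q≤s)) (cong (_* s) (begin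
      gcd (d * q) (d * s)  ≡⟨ c*gcd[m,n]≡gcd[cm,cn] d q s ⟨
      d * gcd q s          ≡⟨ cong (d *_) (coprime⇒gcd≡1 q⊥s) ⟩
      d * 1                ≡⟨ *-identityʳ d ⟩
      d                    ∎))

-- Regrouping the fixed words by divisors.

module _ (k r : ℕ) .{{k≢0 : NonZero k}} where

  private
    -- `D` holds the predecessors of the divisors, in the form used by `sumOverDivisors`, so that
    -- sums over `D` unfold to the sum of the theorem.
    js D : List ℕ
    js = applyUpTo suc k
    D = filter (λ i → suc i ∣? gcd k r) (upTo (gcd k r))

    term : ℕ → ℕ
    term i = (k / suc i) C (r / suc i)

    ∈-D⁺ : ∀ {i} → suc i ∣ k → suc i ∣ r → i ∈ D
    ∈-D⁺ s∣k s∣r = ∈-filter⁺ _ (∈-upTo⁺ (∣⇒≤ s∣g)) s∣g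
      where
      s∣g = gcd-greatest s∣k s∣r
      instance
        g≢0 : NonZero (gcd k r)
        g≢0 = ≢-nonZero (gcd[m,n]≢0 k r (inj₁ (≢-nonZero⁻¹ k)))

    ∈-D⁻ : ∀ {i} → i ∈ D → suc i ∣ gcd k r
    ∈-D⁻ i∈ = proj₂ (∈-filter⁻ (λ i → suc i ∣? gcd k r) {xs = upTo (gcd k r)} i∈)

    D-unique : Unique D
    D-unique = Unique.filter⁺ _ (Unique.upTo⁺ (gcd k r))

  cofactor-unique : ∀ {j i s} → gcd j k * suc s ≡ k → gcd j k * suc i ≡ k → i ≡ s
  cofactor-unique {j} gs≡k gi≡k = suc-injective (*-cancelˡ-≡ _ _ (gcd j k) (trans gi≡k (sym gs≡k)))
    where
    instance
      g≢0 : NonZero (gcd j k)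
      g≢0 = ≢-nonZero (gcd[m,n]≢0 j k (inj₂ (≢-nonZero⁻¹ k)))

  -- The sum has at most one term. The cofactor `suc s` divides `k`, so `s` lies in `D` exactly when
  -- `suc s` divides `r`; otherwise the sum is empty and no word is fixed.
  ∑-cofactor : ∀ j s → gcd j k * suc s ≡ k →
               length (fixedWords k r j) ≡ ∑ (filter (λ i → gcd j k * suc i ≟ k) D) term
  ∑-cofactor j s gs≡k with suc s ∣? r
  ... | no s∤r = trans (length-fixedWords-∤ j s gs≡k s∤r)
    (sym (cong (λ is → ∑ is term) (filter-none _ (All.tabulate λ {i} i∈D gi≡k →
      s∤r (subst (λ i → suc i ∣ r) (cofactor-unique {j} gs≡k gi≡k)
                 (∣-trans (∈-D⁻ i∈D) (gcd[m,n]∣n k r)))))))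
  ... | yes s∣r@(divides m r≡ms) = begin
    length (fixedWords k r j)                        ≡⟨ cong (λ r → length (fixedWords k r j)) r≡ms ⟩
    length (fixedWords k (m * suc s) j)              ≡⟨ length-fixedWords j s m gs≡k ⟩
    gcd j k C m                                      ≡⟨ cong₂ _C_ (m*n/n≡m (gcd j k) (suc s)) (m*n/n≡m m (suc s)) ⟨
    (gcd j k * suc s / suc s) C (m * suc s / suc s)  ≡⟨ cong₂ (λ k r → (k / suc s) C (r / suc s)) gs≡k (sym r≡ms) ⟩
    term s                                           ≡⟨ +-identityʳ _ ⟨
    ∑ [ s ] term                                     ≡⟨ sum-↭ (map-↭ term (filter-singleton _
                                                          D-unique s∈D gs≡k (cofactor-unique {j} gs≡k))) ⟨
    ∑ (filter (λ i → gcd j k * suc i ≟ k) D) term    ∎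
    where
    s∈D : s ∈ D
    s∈D = ∈-D⁺ (divides (gcd j k) (sym gs≡k)) s∣r

  length-fixedWords-∑ : ∀ j → length (fixedWords k r j) ≡
                        ∑ D (λ i → if does (gcd j k * suc i ≟ k) then term i else 0)
  length-fixedWords-∑ j with gcd[m,n]∣n j k
  -- A zero cofactor would force `k` to be 0.
  ... | divides zero    k≡0  = contradiction k≡0 (≢-nonZero⁻¹ k)
  ... | divides (suc s) k≡sg = trans
    (∑-cofactor j s (trans (*-comm (gcd j k) (suc s)) (sym k≡sg)))
    (∑-filter (λ i → gcd j k * suc i ≟ k) term D)

  ∑-cofactor-φ : ∀ {i} → i ∈ D →
                 ∑ js (λ j → if does (gcd j k * suc i ≟ k) then term i else 0) ≡ term i * φ (suc i)
  ∑-cofactor-φ {i} i∈D = begin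
    ∑ js (λ j → if does (gcd?s j) then term i else 0)  ≡⟨ ∑-filter gcd?s _ js ⟨
    ∑ (filter gcd?s js) (λ _ → term i)                 ≡⟨ ∑-const (filter gcd?s js) (term i) ⟩
    count gcd?s js * term i                            ≡⟨ cong (_* term i) (count-gcd≡φ (suc i) s∣k) ⟩
    φ (suc i) * term i                                 ≡⟨ *-comm (φ (suc i)) (term i) ⟩
    term i * φ (suc i)                                 ∎
    where
    gcd?s : Decidable (λ j → gcd j k * suc i ≡ k)
    gcd?s j = gcd j k * suc i ≟ k
    s∣k : suc i ∣ k
    s∣k = ∣-trans (∈-D⁻ i∈D) (gcd[m,n]∣m k r)

  -- With the cofactor condition as an indicator, the sums over rotations and divisors exchange;
  -- each divisor then collects its term once for every rotation having it as cofactor.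
  ∑-fixedWords : ∑ js (length ∘ fixedWords k r) ≡ ∑[ s ∣ gcd k r ] (((k / s) C (r / s)) * φ s)
  ∑-fixedWords = begin
    ∑ js (length ∘ fixedWords k r)
      ≡⟨ ∑-cong js (λ {j} _ → length-fixedWords-∑ j) ⟩
    ∑ js (λ j → ∑ D (λ i → if does (gcd j k * suc i ≟ k) then term i else 0))
      ≡⟨ ∑-comm _ js D ⟩
    ∑ D (λ i → ∑ js (λ j → if does (gcd j k * suc i ≟ k) then term i else 0))
      ≡⟨ ∑-cong D ∑-cofactor-φ ⟩
    ∑[ s ∣ gcd k r ] (((k / s) C (r / s)) * φ s)
      ∎

corollary2 : (k r : ℕ) → k ≥ 2 → r ≥ 1 → r ≤ k →
    k ∣ (∑[ s ∣ gcd k r ] (((k / s) C (r / s)) * φ s))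
corollary2 k r k≥2 _ _ = subst (k ∣_) (∑-fixedWords k r) ∣-∑-fixed-points
  where
  instance
    k≢0 : NonZero k
    k≢0 = >-nonZero (≤-trans (s≤s z≤n) k≥2)
  -- Rotation preserves length and weight, and `k` rotations restore a word of length `k`.
  open Burnside _≟ʷ_ rotate k (words k r) (words-unique k r)
    (λ {w} w∈ → case ∈-words⁻ k r w∈ of λ (∣w∣≡k , weight≡r) →
      ∈-words (trans (length-rotate w) ∣w∣≡k) (trans (weight-rotate w) weight≡r))
    (λ {w} w∈ → trans (cong (fold w rotate) (sym (proj₁ (∈-words⁻ k r w∈)))) (rotate-length w))
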